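{- For each $k\ge 1$ let $\omega^k$ be a shortest $k$-complete word (of length $\lambda(k)$), and define words $W^n$ inductively by $W^1:=1$ and, for $n\ge 1$, $W^{n+1}:=W^n,\,n+1,\,\omega^n$ (concatenation of $W^n$, the letter $n+1$, and $\omega^n$). Then for every $n\ge 1$ the word $W^n$ fixes every $n$-component monotone network. Therefore \[ \lambda_M(n)\ \le\ n+\sum_{i=1}^{n-1}\lambda(i)\ \le\ \frac{n^3}{3}-\frac{3n^2}{2}+\frac{37n}{6}. \]
   Context: An $n$-component (Boolean) network is a function $f=(f_1,\dots,f_n):\{0,1\}^n\to\{0,1\}^n$. Write $[n]=\{1,\dots,n\}$. For $i\in[n]$ and $x\in\{0,1\}^n$, $f^i(x):=(x_1,\dots,x_{i-1},f_i(x),x_{i+1},\dots,x_n)$. For a word $w=i_1i_2\dots i_k$ over the alphabet $[n]$, $f^w:=f^{i_k}\circ\cdots\circ f^{i_1}$ (and $f^\epsilon=\mathrm{id}$ for the empty word). A word $w$ fixes $f$ if $f^w(x)$ is a fixed point of $f$ for every $x\in\{0,1\}^n$. The network $f$ is monotone if $x\le y$ (componentwise) implies $f(x)\le f(y)$ for all $x,y$. $\lambda_M(n)$ denotes the minimum length of a single word over $[n]$ that fixes all $n$-component monotone networks. A word is $n$-complete if it contains every permutation of $[n]$ (viewed as a word $i_1\dots i_n$ using each letter once) as a (not necessarily contiguous) subsequence; $\lambda(n)$ is the length of a shortest $n$-complete word. It is a known result that $\lambda(n)\le n^2-2n+4$ for all $n\ge 1$. -}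

module Defs where

open import Data.Bool.Base as 𝔹 using (Bool; true; false; b≤b; f≤t)
import Data.Bool.Properties as 𝔹
open import Data.Fin.Base using (Fin; zero; suc; fromℕ; inject₁)
open import Data.Fin.Properties using (any?) renaming (_≟_ to _≟ᶠ_)
open import Data.List.Base
  using (List; []; _∷_; [_]; _++_; length; map; allFin; cartesianProductWith; upTo)
import Data.List.Relation.Unary.All as All
import Data.List.Relation.Unary.Any as Any
open import Data.List.Relation.Unary.Any using (here; there)
open import Data.List.Membership.Propositional using (_∈_; lose; find)
open import Data.List.Membership.Propositional.Properties
  using (∈-cartesianProductWith⁺; ∈-allFin; ∈-∃++)
open import Data.List.Relation.Binary.Permutation.Propositional
  using (_↭_; ↭-sym; ↭-trans; ↭-refl; prep)
open import Data.List.Relation.Binary.Permutation.Propositional.Properties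
  using (shift; drop-∷; ↭-length; ∈-resp-↭; ¬x∷xs↭[])
open import Data.List.Properties using (++-assoc; length-tabulate)
open import Data.List.Relation.Binary.Sublist.Propositional
  using (_⊆_; []; _∷_; from∈)
open import Data.List.Relation.Binary.Sublist.Propositional.Properties using (++⁺)
open import Data.Nat.Base
  using (ℕ; zero; suc; _≤_; _<_; s≤s; s<s)
open import Data.Nat.ListAction using (sum)
open import Data.Nat.Induction using (Acc; acc; <-wellFounded)
open import Data.Nat.Properties
  using (_<?_; ≮⇒≥; n<1+n; ≤-reflexive)
open import Data.Product.Base using (_×_; _,_; ∃; proj₁; proj₂)
open import Data.Vec.Base as Vec using (Vec; lookup; _[_]≔_)
open import Data.Vec.Properties using (≡-dec; lookup∘update; lookup∘update′; []≔-lookup)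
open import Data.Vec.Relation.Binary.Pointwise.Inductive as Pointwise using (Pointwise)
open import Data.Vec.Relation.Binary.Pointwise.Extensional
  using (ext; extensional⇒inductive)
open import Function.Base using (id)
open import Relation.Binary.Core using (_Preserves_⟶_)
open import Relation.Binary.PropositionalEquality
  using (_≡_; _≗_; refl; sym; trans; cong; cong₂; subst; subst₂)
open import Relation.Nullary using (Dec; yes; no; ¬_; contradiction)
open import Relation.Nullary.Decidable using (map′; _→-dec_; _×-dec_)
open import Relation.Unary using (Pred; Decidable)
open import Level using (0ℓ)

private
  variable
    n : ℕ

-- The component (and letter) i of [n] = {1,…,n} is the element i ∸ 1 of Fin n.

State : ℕ → Set
State n = Vec Bool n

infix 4 _≤ₛ_

_≤ₛ_ : State n → State n → Set
_≤ₛ_ = Pointwise 𝔹._≤_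

Network : ℕ → Set
Network n = State n → State n

Monotone : Network n → Set
Monotone f = f Preserves _≤ₛ_ ⟶ _≤ₛ_

Word : ℕ → Set
Word n = List (Fin n)

step : Network n → Fin n → State n → State n
step f i x = x [ i ]≔ lookup (f x) i

-- The letters of the word are applied from left to right.

run : Network n → Word n → State n → State n
run f []      x = x
run f (i ∷ w) x = run f w (step f i x)

_Fixes_ : Word n → Network n → Set
w Fixes f = ∀ x → f (run f w x) ≡ run f w x

FixesAllMonotone : Word n → Set
FixesAllMonotone {n} w = (f : Network n) → Monotone f → w Fixes f

Complete : Word n → Set
Complete {n} w = ∀ p → p ↭ allFin n → p ⊆ w

IsLeastLength : Pred (Word n) 0ℓ → ℕ → Set
IsLeastLength P m = (∃ λ w → P w × length w ≡ m) × (∀ w → P w → m ≤ length w)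

-- The minima exist: both properties of words are decidable, and both hold
-- of some word.

private
  ∀? : {A : Set} {P : Pred A 0ℓ} (xs : List A) → (∀ a → a ∈ xs) →
       Decidable P → Dec (∀ a → P a)
  ∀? xs ∈xs P? = map′ (λ ps a → All.lookup ps (∈xs a)) (λ p → All.tabulate λ {a} _ → p a)
                      (All.all? P? xs)

  words< : ℕ → List (Word n)
  words< zero    = []
  words< (suc m) = [] ∷ cartesianProductWith _∷_ (allFin _) (words< m)

  ∈-words< : ∀ {m} (w : Word n) → length w < m → w ∈ words< m
  ∈-words< []      (s≤s _) = here refl
  ∈-words< (i ∷ w) (s≤s l) = there (∈-cartesianProductWith⁺ _∷_ (∈-allFin i) (∈-words< w l))

  leastLength : {P : Pred (Word n) 0ℓ} → Decidable P → ∃ P → ∃ (IsLeastLength P)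
  leastLength {n} {P} P? (w , Pw) = go w Pw (<-wellFounded (length w))
    where
    go : ∀ w → P w → Acc _<_ (length w) → ∃ (IsLeastLength P)
    go w Pw (acc rs)
      with Any.any? (λ v → P? v ×-dec (length v <? length w))
                    (words< (length w))
    ... | yes found = let v , _ , Pv , v<w = find found in go v Pv (rs v<w)
    ... | no  none  = length w , (w , Pw , refl) , λ v Pv →
                      ≮⇒≥ λ v<w → none (lose (∈-words< v v<w) (Pv , v<w))

  infix 4 _↭?_
  _↭?_ : (p q : Word n) → Dec (p ↭ q)
  []      ↭? []      = yes ↭-refl
  []      ↭? (i ∷ q) = no λ r → ¬x∷xs↭[] (↭-sym r)
  (i ∷ p) ↭? q with Any.any? (i ≟ᶠ_) q
  ... | no  i∉q = no λ r → i∉q (∈-resp-↭ r (here refl))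
  ... | yes i∈q with ∈-∃++ i∈q
  ...   | ys , zs , refl = map′ (λ r → ↭-trans (prep i r) (↭-sym (shift i ys zs)))
                                (λ r → drop-∷ (↭-trans r (shift i ys zs)))
                                (p ↭? ys ++ zs)

  length-perm : {p : Word n} → p ↭ allFin n → length p ≡ n
  length-perm r = trans (↭-length r) (length-tabulate id)

  complete? : Decidable (Complete {n})
  complete? {n} w =
    map′ (λ ps p p↭ → All.lookup ps (∈-words< p (s≤s (≤-reflexive (length-perm p↭)))) p↭)
         (λ c → All.tabulate λ {p} _ → c p)
         (All.all? (λ p → (p ↭? allFin n) →-dec (p ⊆? w)) (words< (suc n)))
    where
    open import Data.List.Relation.Binary.Sublist.DecPropositional (_≟ᶠ_ {n}) using (_⊆?_)

  copies : ℕ → Word n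
  copies zero    = []
  copies (suc m) = allFin _ ++ copies m

  ⊆-copies : (p : Word n) → p ⊆ copies (length p)
  ⊆-copies []      = []
  ⊆-copies (i ∷ p) = ++⁺ (from∈ (∈-allFin i)) (⊆-copies p)

  copies-complete : Complete (copies {n} n)
  copies-complete {n} p r =
    subst (λ m → p ⊆ copies m) (length-perm r) (⊆-copies p)

  bools : List Bool
  bools = true ∷ false ∷ []

  states : ∀ n → List (State n)
  states zero    = [ Vec.[] ]
  states (suc n) = cartesianProductWith Vec._∷_ bools (states n)

  ∈-states : (x : State n) → x ∈ states n
  ∈-states Vec.[]          = here refl
  ∈-states (true  Vec.∷ x) = ∈-cartesianProductWith⁺ Vec._∷_ {xs = bools} (here refl) (∈-states x)
  ∈-states (false Vec.∷ x) = ∈-cartesianProductWith⁺ Vec._∷_ {xs = bools} (there (here refl)) (∈-states x)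

  _≟ₛ_ : (x y : State n) → Dec (x ≡ y)
  _≟ₛ_ = ≡-dec 𝔹._≟_

  override : State n → State n → Network n → Network n
  override x y f z with x ≟ₛ z
  ... | yes _ = y
  ... | no  _ = f z

  -- Up to pointwise equality, every network on the given states.

  networksOn : List (State n) → List (Network n)
  networksOn []       = [ id ]
  networksOn (x ∷ xs) = cartesianProductWith (override x) (states _) (networksOn xs)

  networksOn-complete : (xs : List (State n)) (f : Network n) →
    ∃ λ (g : Network n) → g ∈ networksOn xs × (∀ x → x ∈ xs → f x ≡ g x)
  networksOn-complete []       f = id , here refl , λ _ ()
  networksOn-complete (x ∷ xs) f with networksOn-complete xs f
  ... | g , g∈ , f≗g = override x (f x) g ,
        ∈-cartesianProductWith⁺ (override x) (∈-states (f x)) g∈ , eq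
    where
    eq : ∀ z → z ∈ x ∷ xs → f z ≡ override x (f x) g z
    eq z z∈ with x ≟ₛ z
    eq z z∈          | yes x≡z = cong f (sym x≡z)
    eq z (here z≡x)  | no  x≢z = contradiction (sym z≡x) x≢z
    eq z (there z∈)  | no  _   = f≗g z z∈

  networks : ∀ n → List (Network n)
  networks n = networksOn (states n)

  networks-complete : (f : Network n) → ∃ λ (g : Network n) → g ∈ networks n × f ≗ g
  networks-complete {n} f =
    let g , g∈ , f≗g = networksOn-complete (states n) f in
    g , g∈ , λ x → f≗g x (∈-states x)

  run-cong : {f g : Network n} → f ≗ g → ∀ w → run f w ≗ run g w
  run-cong f≗g []      x = refl
  run-cong {f = f} {g} f≗g (i ∷ w) x
    rewrite f≗g x = run-cong f≗g w (step g i x)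

  fixes-resp : {f g : Network n} → f ≗ g → ∀ w x →
               g (run g w x) ≡ run g w x → f (run f w x) ≡ run f w x
  fixes-resp f≗g w x e rewrite run-cong f≗g w x = trans (f≗g _) e

  monotone-resp : {f g : Network n} → f ≗ g → Monotone f → Monotone g
  monotone-resp f≗g mono x≤y = subst₂ _≤ₛ_ (f≗g _) (f≗g _) (mono x≤y)

  monotone? : Decidable (Monotone {n})
  monotone? {n} f =
    map′ (λ m {x} {y} → m x y) (λ m x y → m {x} {y})
         (∀? (states n) ∈-states λ x → ∀? (states n) ∈-states λ y →
           Pointwise.decidable 𝔹._≤?_ x y →-dec Pointwise.decidable 𝔹._≤?_ (f x) (f y))

  fixes? : (w : Word n) (f : Network n) → Dec (w Fixes f)
  fixes? {n} w f = ∀? (states n) ∈-states λ x → f (run f w x) ≟ₛ run f w x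

  FixesListed : List (Network n) → Word n → Set
  FixesListed fs w = ∀ f → f ∈ fs → Monotone f → w Fixes f

  fixesAll : (w : Word n) → FixesListed (networks n) w → FixesAllMonotone w
  fixesAll w fix f mono x =
    let g , g∈ , f≗g = networks-complete f in
    fixes-resp f≗g w x (fix g g∈ (monotone-resp f≗g mono) x)

  fixesAllMonotone? : Decidable (FixesAllMonotone {n})
  fixesAllMonotone? {n} w =
    map′ (λ ps → fixesAll w λ f f∈ → All.lookup ps f∈)
         (λ fix → All.tabulate λ {f} _ → fix f)
         (All.all? (λ f → monotone? f →-dec fixes? w f) (networks n))

  -- From any state a monotone network reaches a fixed point: first switch
  -- components on while possible, then off.

  ones zeros : State n → ℕ
  ones  = Vec.count (𝔹._≟ true)
  zeros = Vec.count (𝔹._≟ false)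

  ones-< : ∀ (x : State n) i → lookup x i ≡ true → ones (x [ i ]≔ false) < ones x
  ones-< (true  Vec.∷ x) zero    refl = n<1+n _
  ones-< (true  Vec.∷ x) (suc i) e    = s<s (ones-< x i e)
  ones-< (false Vec.∷ x) (suc i) e    = ones-< x i e

  zeros-< : ∀ (x : State n) i → lookup x i ≡ false → zeros (x [ i ]≔ true) < zeros x
  zeros-< (false Vec.∷ x) zero    refl = n<1+n _
  zeros-< (false Vec.∷ x) (suc i) e    = s<s (zeros-< x i e)
  zeros-< (true  Vec.∷ x) (suc i) e    = zeros-< x i e

  Reaches : Network n → State n → Set
  Reaches f x = ∃ λ w → f (run f w x) ≡ run f w x

  reaches-step : ∀ {f : Network n} {x} i {b} → lookup (f x) i ≡ b →
                 Reaches f (x [ i ]≔ b) → Reaches f x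
  reaches-step i refl (w , e) = i ∷ w , e

  ≤ₛ-intro : {x y : State n} → (∀ i → ¬ (lookup x i ≡ true × lookup y i ≡ false)) → x ≤ₛ y
  ≤ₛ-intro {x = x} {y} h = extensional⇒inductive (ext λ i → aux (lookup x i) (lookup y i) (h i))
    where
    aux : ∀ a b → ¬ (a ≡ true × b ≡ false) → a 𝔹.≤ b
    aux false false _ = b≤b
    aux false true  _ = f≤t
    aux true  true  _ = b≤b
    aux true  false h = contradiction (refl , refl) h

  ≤ₛ-update : (x : State n) (i : Fin n) → lookup x i ≡ true → x [ i ]≔ false ≤ₛ x
  ≤ₛ-update (true Vec.∷ x) zero    refl = f≤t Pointwise.∷ Pointwise.refl b≤b
  ≤ₛ-update (b Vec.∷ x)    (suc i) e    = b≤b Pointwise.∷ ≤ₛ-update x i e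

  descend : ∀ {f : Network n} → Monotone f → ∀ x → f x ≤ₛ x →
            Acc _<_ (ones x) → Reaches f x
  descend {f = f} mono x fx≤x (acc rs)
    with any? (λ i → (lookup x i 𝔹.≟ true) ×-dec (lookup (f x) i 𝔹.≟ false))
  ... | no  none = [] , sym (antisym (≤ₛ-intro λ i p → none (i , p)) fx≤x)
    where
    antisym : ∀ {m} {y z : State m} → y ≤ₛ z → z ≤ₛ y → y ≡ z
    antisym Pointwise.[]        Pointwise.[]        = refl
    antisym (a≤b Pointwise.∷ p) (b≤a Pointwise.∷ q) =
      cong₂ Vec._∷_ (𝔹.≤-antisym a≤b b≤a) (antisym p q)
  ... | yes (i , xi , fxi) =
    reaches-step i fxi (descend mono y fy≤y (rs (ones-< x i xi)))
    where
    y = x [ i ]≔ false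
    fy≤fx : f y ≤ₛ f x
    fy≤fx = mono (≤ₛ-update x i xi)
    fy≤y : f y ≤ₛ y
    fy≤y = extensional⇒inductive (ext λ j → at j)
      where
      at : ∀ j → lookup (f y) j 𝔹.≤ lookup y j
      at j with j ≟ᶠ i
      ... | yes refl = subst (lookup (f y) i 𝔹.≤_)
                             (trans fxi (sym (lookup∘update i x false)))
                             (Pointwise.lookup fy≤fx i)
      ... | no  j≢i  = subst (lookup (f y) j 𝔹.≤_)
                             (sym (lookup∘update′ j≢i x false))
                             (𝔹.≤-trans (Pointwise.lookup fy≤fx j) (Pointwise.lookup fx≤x j))

  ascend : ∀ {f : Network n} → Monotone f → ∀ x → Acc _<_ (zeros x) → Reaches f x
  ascend {f = f} mono x (acc rs)
    with any? (λ i → (lookup (f x) i 𝔹.≟ true) ×-dec (lookup x i 𝔹.≟ false))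
  ... | no  none = descend mono x (≤ₛ-intro λ i p → none (i , p)) (<-wellFounded _)
  ... | yes (i , fxi , xi) =
    reaches-step i fxi (ascend mono _ (rs (zeros-< x i xi)))

  run-++ : (f : Network n) → ∀ u v x → run f (u ++ v) x ≡ run f v (run f u x)
  run-++ f []      v x = refl
  run-++ f (i ∷ u) v x = run-++ f u v (step f i x)

  run-fixed : {f : Network n} → ∀ w {x} → f x ≡ x → run f w x ≡ x
  run-fixed         []      e = refl
  run-fixed {f = f} (i ∷ w) {x} e
    rewrite e | []≔-lookup x i = run-fixed {f = f} w e

  fixes-++ : {f : Network n} → ∀ u v {x} → f (run f u x) ≡ run f u x →
             f (run f (u ++ v) x) ≡ run f (u ++ v) x
  fixes-++ {f = f} u v {x} e
    rewrite run-++ f u v x | run-fixed {f = f} v e = e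

  fixer : ∀ (f : Network n) → Monotone f → (xs : List (State n)) → ∀ u →
          ∃ λ w → ∀ x → x ∈ xs → f (run f (u ++ w) x) ≡ run f (u ++ w) x
  fixer f mono []       u = [] , λ _ ()
  fixer f mono (x ∷ xs) u with fixer f mono xs u
  ... | w , fix with ascend mono (run f (u ++ w) x) (<-wellFounded _)
  ...   | v , e = w ++ v , λ
    { z (here refl) → subst (λ t → f (run f t z) ≡ run f t z) (++-assoc u w v)
                        (subst (λ y → f y ≡ y) (sym (run-++ f (u ++ w) v z)) e)
    ; z (there z∈)  → subst (λ t → f (run f t z) ≡ run f t z) (++-assoc u w v)
                        (fixes-++ (u ++ w) v (fix z z∈)) }

  fixerListed : (fs : List (Network n)) → ∃ (FixesListed fs)
  fixerListed []       = [] , λ _ ()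
  fixerListed {n} (f ∷ fs) with fixerListed fs | monotone? f
  ... | u , fix | no ¬mono = u , λ
    { g (here refl) mono → contradiction (λ {x} {y} → mono {x} {y}) ¬mono
    ; g (there g∈)       → fix g g∈ }
  ... | u , fix | yes mono with fixer f mono (states n) u
  ...   | w , e = u ++ w , λ
    { g (here refl) _ x  → e x (∈-states x)
    ; g (there g∈)  m x  → fixes-++ u w (fix g g∈ m x) }

abstract
  leastComplete : ∀ n → ∃ (IsLeastLength (Complete {n}))
  leastComplete n = leastLength complete? (copies n , copies-complete)

  leastFixing : ∀ n → ∃ (IsLeastLength (FixesAllMonotone {n}))
  leastFixing n = leastLength fixesAllMonotone?
    (let w , fix = fixerListed (networks n) in w , fixesAll w fix)

-- Λ n is λ(n) and Λᴹ n is λ_M(n) (`λ` itself is a keyword).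

Λ : ℕ → ℕ
Λ n = proj₁ (leastComplete n)

Λ-isLeast : ∀ n → IsLeastLength (Complete {n}) (Λ n)
Λ-isLeast n = proj₂ (leastComplete n)

Λᴹ : ℕ → ℕ
Λᴹ n = proj₁ (leastFixing n)

Λᴹ-isLeast : ∀ n → IsLeastLength (FixesAllMonotone {n}) (Λᴹ n)
Λᴹ-isLeast n = proj₂ (leastFixing n)

ShortestComplete : Word n → Set
ShortestComplete {n} w = Complete w × length w ≡ Λ n

-- `inject₁` regards a word over [n] as a word over [n + 1], and `fromℕ n`
-- is the new letter n + 1.  The value at 0 is a placeholder.

W : (∀ k → Word k) → ∀ n → Word n
W ω zero            = []
W ω (suc zero)      = [ zero ]
W ω (suc n@(suc _)) = map inject₁ (W ω n) ++ fromℕ n ∷ map inject₁ (ω n)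

-- λ(1) + … + λ(m)

∑Λ : ℕ → ℕ
∑Λ m = sum (map (λ i → Λ (suc i)) (upTo m))

{-# OPTIONS --safe #-}

-- Fixing: once W^n has stabilised the first n components, updating the last
-- one either changes nothing or moves the state up or down, and then the
-- restriction of f to the first n components is in a state x comparable to
-- its image.  From there some ordering of the n letters leads monotonically
-- to a fixed point, and by monotonicity so does any word containing it.
--
-- Length: λ(m + 1) ≤ m² + 3.  Take the cyclic word 1 … m 1 … m … of length
-- 2 + m (m − 1) and insert the remaining letter 0 after the first letter and
-- then after every m − 1 letters.  Consecutive letters of a permutation differ,
-- so each one after the first costs at most m − 1 cyclic letters.

module Submission where

open import Defs
open import Data.Integer.Base using (+_)
open import Data.Nat.Base using (ℕ; _+_; _*_; _^_; _∸_; _≤_)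
open import Data.Product.Base using (_×_)
open import Data.Rational.Base as ℚ using (_/_)

open import Data.Bool.Base as 𝔹 using (Bool; true; false; b≤b; f≤t)
import Data.Bool.Properties as 𝔹
open import Data.Fin.Base using (Fin; zero; suc; fromℕ; inject₁; toℕ)
open import Data.Fin.Properties using (any?; toℕ-injective; toℕ-fromℕ<; toℕ<n)
  renaming (_≟_ to _≟ᶠ_)
import Data.Integer.Base as ℤ
import Data.Integer.Properties as ℤ
import Data.Integer.Tactic.RingSolver as ℤSolver
open import Data.List.Base using (List; []; _∷_; [_]; _++_; length; map; allFin; upTo; applyUpTo)
open import Data.List.Membership.Propositional using (_∈_)
open import Data.List.Membership.Propositional.Properties using (∈-allFin; ∈-∃++)
open import Data.List.Properties
  using (length-++; length-map; length-applyUpTo; length-tabulate; map-++; upTo-∷ʳ; ++-assoc)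
open import Data.List.Relation.Binary.Permutation.Propositional
  using (_↭_; ↭-sym; ↭-trans; ↭-refl; prep; ↭⇒↭ₛ)
open import Data.List.Relation.Binary.Permutation.Propositional.Properties
  using (shift; ↭-length; ∈-resp-↭; ↭-empty-inv; ↭-singleton-inv)
import Data.List.Relation.Binary.Permutation.Setoid.Properties as ↭ₛ
open import Data.List.Relation.Binary.Sublist.Propositional
  using (_⊆_; []; _∷_; _∷ʳ_; minimum; ⊆-refl; ⊆-trans)
open import Data.List.Relation.Binary.Sublist.Propositional.Properties
  using (++⁺; ∷ˡ⁻)
open import Data.List.Relation.Unary.All as All using (All; []; _∷_)
import Data.List.Relation.Unary.All.Properties as All
open import Data.List.Relation.Unary.AllPairs using ([]; _∷_)
open import Data.List.Relation.Unary.Any using (here; there)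
open import Data.List.Relation.Unary.Unique.Propositional using (Unique)
open import Data.List.Relation.Unary.Unique.Propositional.Properties using (allFin⁺)
open import Data.Nat.Base as ℕ using (zero; suc; _<_; z≤n; s≤s; s≤s⁻¹)
open import Data.Nat.DivMod hiding (_/_)
open import Data.Nat.ListAction using (sum)
open import Data.Nat.ListAction.Properties using (sum-++)
open import Data.Nat.Properties
open import Data.Nat.Tactic.RingSolver using (solve-∀)
open import Data.Product.Base using (_,_; ∃; proj₁; proj₂)
import Data.Rational.Properties as ℚ
import Data.Rational.Unnormalised.Base as ℚᵘ
import Data.Rational.Unnormalised.Properties as ℚᵘ
open import Data.Sum.Base using (_⊎_; inj₁; inj₂)
open import Data.Vec.Base as Vec using (Vec; lookup; _[_]≔_; initLast; tabulate)
open import Data.Vec.Properties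
  using (lookup∘update; lookup∘update′; []≔-lookup; lookup∘tabulate; tabulate∘lookup; tabulate-cong)
import Data.Vec.Relation.Binary.Pointwise.Inductive as Pointwise
open import Data.Vec.Relation.Binary.Pointwise.Extensional using (ext; extensional⇒inductive)
open import Function.Base using (_∘_; id)
open import Relation.Binary.PropositionalEquality
  using (_≡_; _≢_; _≗_; refl; sym; trans; cong; cong₂; subst; subst₂; setoid; module ≡-Reasoning)
open import Relation.Nullary using (yes; no; contradiction)
open import Relation.Nullary.Decidable using (_×-dec_; ¬?; decidable-stable)

private
  variable
    n : ℕ
    c : Bool
    f : Network n
    x y : State n
    u w : Word n

-- Isotone networks and complete words.

-- For c = true this is ≤ₛ and for c = false it is the reverse order; ascents
-- and descents towards a fixed point are then treated at once.

infix 4 _⊑[_]_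

_⊑[_]_ : State n → Bool → State n → Set
x ⊑[ c ] y = ∀ i → lookup x i ≡ c → lookup y i ≡ c

⊑-antisym : x ⊑[ c ] y → y ⊑[ c ] x → x ≡ y
⊑-antisym {x = x} {c} {y} x⊑y y⊑x =
  trans (sym (tabulate∘lookup x)) (trans (tabulate-cong eq) (tabulate∘lookup y))
  where
  bool-eq : ∀ a b c → (a ≡ c → b ≡ c) → (b ≡ c → a ≡ c) → a ≡ b
  bool-eq false false _     _ _ = refl
  bool-eq true  true  _     _ _ = refl
  bool-eq false true  false p _ = sym (p refl)
  bool-eq false true  true  _ q = q refl
  bool-eq true  false false _ q = q refl
  bool-eq true  false true  p _ = sym (p refl)
  eq : lookup x ≗ lookup y
  eq i = bool-eq _ _ c (x⊑y i) (y⊑x i)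

≤ₛ-pointwise : (∀ i → lookup x i 𝔹.≤ lookup y i) → x ≤ₛ y
≤ₛ-pointwise x≤y = extensional⇒inductive (ext x≤y)

Isotone : Bool → Network n → Set
Isotone c f = ∀ x y → x ⊑[ c ] y → f x ⊑[ c ] f y

monotone⇒isotone : Monotone f → ∀ c → Isotone c f
monotone⇒isotone mono true x y x⊑y i =
  true-up (Pointwise.lookup (mono (≤ₛ-pointwise λ j → up (x⊑y j))) i)
  where
  up : ∀ {a b} → (a ≡ true → b ≡ true) → a 𝔹.≤ b
  up {false} {false} _ = b≤b
  up {false} {true}  _ = f≤t
  up {true}          p with refl ← p refl = b≤b
  true-up : ∀ {a b} → a 𝔹.≤ b → a ≡ true → b ≡ true
  true-up b≤b e = e
-- Here `x ⊑[ false ] y` means `y ≤ₛ x`, so monotonicity is applied from `y` to `x`.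
monotone⇒isotone mono false x y x⊑y i =
  false-down (Pointwise.lookup (mono (≤ₛ-pointwise λ j → down (x⊑y j))) i)
  where
  down : ∀ {a b} → (b ≡ false → a ≡ false) → a 𝔹.≤ b
  down {false} {false} _ = b≤b
  down {false} {true}  _ = f≤t
  down {true}  {true}  _ = b≤b
  down {true}  {false} p with () ← p refl
  false-down : ∀ {a b} → a 𝔹.≤ b → b ≡ false → a ≡ false
  false-down b≤b e = e

run-++ : (f : Network n) → ∀ u v x → run f (u ++ v) x ≡ run f v (run f u x)
run-++ f []      v x = refl
run-++ f (i ∷ u) v x = run-++ f u v (step f i x)

run-fixed : (f : Network n) → ∀ w {x} → f x ≡ x → run f w x ≡ x
run-fixed f []      e = refl
run-fixed f (i ∷ w) {x} e rewrite e | []≔-lookup x i = run-fixed f w e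

step-isotone : Isotone c f → ∀ i → Isotone c (step f i)
step-isotone {f = f} iso i x y x⊑y j with j ≟ᶠ i
... | yes refl rewrite lookup∘update i x (lookup (f x) i) | lookup∘update i y (lookup (f y) i) =
  iso x y x⊑y i
... | no  j≢i  rewrite lookup∘update′ j≢i x (lookup (f x) i) | lookup∘update′ j≢i y (lookup (f y) i) =
  x⊑y j

run-isotone : Isotone c f → ∀ w → Isotone c (run f w)
run-isotone iso []      x y x⊑y = x⊑y
run-isotone {f = f} iso (i ∷ w) x y x⊑y =
  run-isotone {f = f} iso w _ _ (step-isotone {f = f} iso i x y x⊑y)

⊑-step : x ⊑[ c ] f x → ∀ i → x ⊑[ c ] step f i x
⊑-step {x = x} {f = f} x⊑fx i j with j ≟ᶠ i
... | yes refl rewrite lookup∘update i x (lookup (f x) i)      = x⊑fx i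
... | no  j≢i  rewrite lookup∘update′ j≢i x (lookup (f x) i) = id

step-⊑ : x ⊑[ c ] f x → ∀ i → step f i x ⊑[ c ] f x
step-⊑ {x = x} {f = f} x⊑fx i j with j ≟ᶠ i
... | yes refl rewrite lookup∘update i x (lookup (f x) i)      = id
... | no  j≢i  rewrite lookup∘update′ j≢i x (lookup (f x) i) = x⊑fx j

-- The state `step f i x` lies between `x` and `f x`. Isotony turns the first comparison into
-- `f x ⊑[ c ] f (step f i x)`, and the second one precedes it.
step-progressive : Isotone c f → x ⊑[ c ] f x → ∀ i → step f i x ⊑[ c ] f (step f i x)
step-progressive {f = f} {x = x} iso x⊑fx i j =
  iso x (step f i x) (⊑-step {f = f} x⊑fx i) j ∘ step-⊑ {f = f} x⊑fx i j

-- Induction on the embedding: a letter of `w` outside `u` only moves `y` further in the direction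
-- `c`, and a common letter preserves the comparison. With `u = []`, running `w` never falls behind
-- its start.
run-⊆ : Isotone c f → u ⊆ w → x ⊑[ c ] y → y ⊑[ c ] f y → run f u x ⊑[ c ] run f w y
run-⊆ iso [] x⊑y _ = x⊑y
run-⊆ {f = f} iso (i ∷ʳ τ) x⊑y y⊑fy =
  run-⊆ {f = f} iso τ (λ j → ⊑-step {f = f} y⊑fy i j ∘ x⊑y j)
    (step-progressive {f = f} iso y⊑fy i)
run-⊆ {f = f} {x = x} {y} iso (_∷_ {x = i} refl τ) x⊑y y⊑fy =
  run-⊆ {f = f} {x = step f i x} iso τ (step-isotone {f = f} iso i x y x⊑y)
    (step-progressive {f = f} iso y⊑fy i)

-- Greedy choice: update a component that `f` wants to change to `c`. It never leaves `c` again, so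
-- its letter can be struck from `r`; the invariant is that every component outside `r` already has
-- value `c`.
ascent : Isotone c f → ∀ (r : Word n) x → x ⊑[ c ] f x →
         (∀ i → i ∈ r ⊎ lookup x i ≡ c) →
         ∃ λ p → p ↭ r × f (run f p x) ≡ run f p x
ascent {c = c} {f = f} iso r = go (length r) r refl
  where
  -- The recursion is on the length `k`, since `ys ++ zs` is not a subterm of `r`.
  go : ∀ k r → length r ≡ k → ∀ x → x ⊑[ c ] f x → (∀ i → i ∈ r ⊎ lookup x i ≡ c) →
       ∃ λ p → p ↭ r × f (run f p x) ≡ run f p x
  go k r len x x⊑fx rest
    with any? (λ i → (lookup (f x) i 𝔹.≟ c) ×-dec ¬? (lookup x i 𝔹.≟ c))
  -- The state is already fixed, so the remaining letters may follow in any order.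
  ... | no none = r , ↭-refl , subst (λ t → f t ≡ t) (sym (run-fixed f r fixed)) fixed
    where
    fixed : f x ≡ x
    fixed = ⊑-antisym (λ i e → decidable-stable (lookup x i 𝔹.≟ c) λ ne → none (i , e , ne)) x⊑fx
  ... | yes (i , fxi , xi) with rest i
  ...   | inj₂ e = contradiction e xi
  ...   | inj₁ i∈r with ∈-∃++ i∈r
  go zero    _ len x x⊑fx rest | yes (i , fxi , xi) | inj₁ i∈r | ys , zs , refl
    with () ← trans (sym (↭-length (shift i ys zs))) len
  go (suc k) _ len x x⊑fx rest | yes (i , fxi , xi) | inj₁ i∈r | ys , zs , refl =
    let p , p↭ , fixed = go k (ys ++ zs) (suc-injective (trans (sym (↭-length (shift i ys zs))) len))
                            (step f i x) (step-progressive {f = f} iso x⊑fx i) rest′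
    in i ∷ p , ↭-trans (prep i p↭) (↭-sym (shift i ys zs)) , fixed
    where
    rest′ : ∀ j → j ∈ ys ++ zs ⊎ lookup (step f i x) j ≡ c
    rest′ j with j ≟ᶠ i
    ... | yes refl = inj₂ (trans (lookup∘update i x _) fxi)
    ... | no j≢i with rest j
    ...   | inj₂ xj = inj₂ (trans (lookup∘update′ j≢i x _) xj)
    ...   | inj₁ j∈ with ∈-resp-↭ (shift i ys zs) j∈
    ...     | here j≡i = contradiction j≡i j≢i
    ...     | there j∈′ = inj₁ j∈′

-- The complete word gets at least as far as the ordering p that it contains,
-- and it cannot get beyond the fixed point z.

complete-fixes : Isotone c f → Complete w → x ⊑[ c ] f x → f (run f w x) ≡ run f w x
complete-fixes {c = c} {f = f} {w = w} {x = x} iso complete x⊑fx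
  with ascent {f = f} iso (allFin _) x x⊑fx (λ i → inj₁ (∈-allFin i))
... | p , p↭ , fixed = subst (λ t → f t ≡ t) z≡ fixed
  where
  z = run f p x
  x⊑z : x ⊑[ c ] z
  x⊑z = run-⊆ {f = f} {x = x} iso (minimum p) (λ _ → id) x⊑fx
  z≡ : z ≡ run f w x
  z≡ = ⊑-antisym (run-⊆ {f = f} iso (complete p p↭) (λ _ → id) x⊑fx)
         (subst (run f w x ⊑[ c ]_) (run-fixed f w fixed) (run-isotone {f = f} iso w x z x⊑z))

-- Adding one component to a network.

lookup-inject₁ : ∀ {A : Set} (xs : Vec A n) a i → lookup (xs Vec.∷ʳ a) (inject₁ i) ≡ lookup xs i
lookup-inject₁ (_ Vec.∷ _)  a zero    = refl
lookup-inject₁ (_ Vec.∷ xs) a (suc i) = lookup-inject₁ xs a i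

lookup-fromℕ : ∀ {A : Set} (xs : Vec A n) a → lookup (xs Vec.∷ʳ a) (fromℕ n) ≡ a
lookup-fromℕ Vec.[]       a = refl
lookup-fromℕ (_ Vec.∷ xs) a = lookup-fromℕ xs a

update-inject₁ : ∀ {A : Set} (xs : Vec A n) a i b →
                 (xs Vec.∷ʳ a) [ inject₁ i ]≔ b ≡ (xs [ i ]≔ b) Vec.∷ʳ a
update-inject₁ (_ Vec.∷ _)  a zero    b = refl
update-inject₁ (x Vec.∷ xs) a (suc i) b = cong (x Vec.∷_) (update-inject₁ xs a i b)

update-fromℕ : ∀ {A : Set} (xs : Vec A n) a b →
               (xs Vec.∷ʳ a) [ fromℕ n ]≔ b ≡ xs Vec.∷ʳ b
update-fromℕ Vec.[]       a b = refl
update-fromℕ (x Vec.∷ xs) a b = cong (x Vec.∷_) (update-fromℕ xs a b)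

tabulate-∷ʳ-lookup : ∀ {A : Set} (xs : Vec A (suc n)) →
                     tabulate (lookup xs ∘ inject₁) Vec.∷ʳ lookup xs (fromℕ n) ≡ xs
tabulate-∷ʳ-lookup {zero}  (x Vec.∷ Vec.[]) = refl
tabulate-∷ʳ-lookup {suc n} (x Vec.∷ xs)     = cong (x Vec.∷_) (tabulate-∷ʳ-lookup xs)

restrict : Network (suc n) → Bool → Network n
restrict f b x = tabulate (lookup (f (x Vec.∷ʳ b)) ∘ inject₁)

∷ʳ-mono-≤ₛ : ∀ {a b} → x ≤ₛ y → a 𝔹.≤ b → x Vec.∷ʳ a ≤ₛ y Vec.∷ʳ b
∷ʳ-mono-≤ₛ Pointwise.[]        a≤b = a≤b Pointwise.∷ Pointwise.[]
∷ʳ-mono-≤ₛ (p Pointwise.∷ x≤y) a≤b = p Pointwise.∷ ∷ʳ-mono-≤ₛ x≤y a≤b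

-- The value `c` is the top of its own order, so `b` may be arbitrary. This compares the states
-- before and after an update of the last component.
∷ʳ-⊑ : ∀ (x y : State n) {b} → x ⊑[ c ] y → x Vec.∷ʳ b ⊑[ c ] y Vec.∷ʳ c
∷ʳ-⊑ Vec.[]      Vec.[]      x⊑y zero    _ = refl
∷ʳ-⊑ (_ Vec.∷ _) (_ Vec.∷ _) x⊑y zero    e = x⊑y zero e
∷ʳ-⊑ (_ Vec.∷ x) (_ Vec.∷ y) x⊑y (suc i) e = ∷ʳ-⊑ x y (x⊑y ∘ suc) i e

restrict-mono : {f : Network (suc n)} → Monotone f → ∀ {a b} → a 𝔹.≤ b → x ≤ₛ y →
                restrict f a x ≤ₛ restrict f b y
restrict-mono {f = f} mono a≤b x≤y = ≤ₛ-pointwise λ i →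
  subst₂ 𝔹._≤_ (sym (lookup∘tabulate _ i)) (sym (lookup∘tabulate _ i))
    (Pointwise.lookup (mono (∷ʳ-mono-≤ₛ x≤y a≤b)) (inject₁ i))

-- Letters of the form `inject₁ i` never touch the last component, so `b` stays a constant parameter
-- throughout the run.
run-restrict : (f : Network (suc n)) → ∀ w x b →
               run f (map inject₁ w) (x Vec.∷ʳ b) ≡ run (restrict f b) w x Vec.∷ʳ b
run-restrict f []      x b = refl
run-restrict f (i ∷ w) x b = trans (cong (run f (map inject₁ w)) step-eq)
                                   (run-restrict f w (step (restrict f b) i x) b)
  where
  step-eq : step f (inject₁ i) (x Vec.∷ʳ b) ≡ step (restrict f b) i x Vec.∷ʳ b
  step-eq = trans (update-inject₁ x b i _)
    (cong (λ a → (x [ i ]≔ a) Vec.∷ʳ b) (sym (lookup∘tabulate _ i)))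

restrict-fixed : (f : Network (suc n)) → ∀ {x b} → restrict f b x ≡ x →
                 lookup (f (x Vec.∷ʳ b)) (fromℕ n) ≡ b → f (x Vec.∷ʳ b) ≡ x Vec.∷ʳ b
restrict-fixed f e e′ = trans (sym (tabulate-∷ʳ-lookup _)) (cong₂ Vec._∷ʳ_ e e′)

-- If the letter n + 1 changes the last component to c′, then the stable first
-- components y₁ satisfy y₁ ⊑[ c′ ] restrict f c′ y₁.

fixes-extend : (w v : Word n) → FixesAllMonotone w → Complete v →
               FixesAllMonotone (map inject₁ w ++ fromℕ n ∷ map inject₁ v)
fixes-extend {n} w v fix complete f mono x₀ with initLast x₀
... | x , b , refl = subst (λ t → f t ≡ t) (sym run-eq) fixed
  where
  y₁ = run (restrict f b) w x
  c′ = lookup (f (y₁ Vec.∷ʳ b)) (fromℕ n)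
  z₁ = run (restrict f c′) v y₁
  y-fixed : restrict f b y₁ ≡ y₁
  y-fixed = fix (restrict f b) (restrict-mono mono b≤b) x
  run-eq : run f (map inject₁ w ++ fromℕ n ∷ map inject₁ v) (x Vec.∷ʳ b) ≡ z₁ Vec.∷ʳ c′
  run-eq = begin
    run f (map inject₁ w ++ fromℕ n ∷ map inject₁ v) (x Vec.∷ʳ b)
      ≡⟨ run-++ f (map inject₁ w) _ _ ⟩
    run f (fromℕ n ∷ map inject₁ v) (run f (map inject₁ w) (x Vec.∷ʳ b))
      ≡⟨ cong (run f (fromℕ n ∷ map inject₁ v)) (run-restrict f w x b) ⟩
    run f (map inject₁ v) (step f (fromℕ n) (y₁ Vec.∷ʳ b))
      ≡⟨ cong (run f (map inject₁ v)) (update-fromℕ y₁ b c′) ⟩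
    run f (map inject₁ v) (y₁ Vec.∷ʳ c′)
      ≡⟨ run-restrict f v y₁ c′ ⟩
    z₁ Vec.∷ʳ c′ ∎
    where open ≡-Reasoning
  fixed : f (z₁ Vec.∷ʳ c′) ≡ z₁ Vec.∷ʳ c′
  fixed with c′ 𝔹.≟ b
  ... | yes c≡b = subst (λ a → f (a Vec.∷ʳ c′) ≡ a Vec.∷ʳ c′) (sym z≡y₁)
                    (restrict-fixed f y-fixed′ (cong (λ a → lookup (f (y₁ Vec.∷ʳ a)) (fromℕ n)) c≡b))
    where
    y-fixed′ : restrict f c′ y₁ ≡ y₁
    y-fixed′ = trans (cong (λ a → restrict f a y₁) c≡b) y-fixed
    z≡y₁ : z₁ ≡ y₁
    z≡y₁ = run-fixed (restrict f c′) v y-fixed′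
  ... | no  _   = restrict-fixed f z-fixed last-fixed
    where
    g-iso : Isotone c′ (restrict f c′)
    g-iso = monotone⇒isotone (restrict-mono mono b≤b) c′
    up : ∀ y′ → y₁ ⊑[ c′ ] y′ → f (y₁ Vec.∷ʳ b) ⊑[ c′ ] f (y′ Vec.∷ʳ c′)
    up y′ y⊑ = monotone⇒isotone mono c′ _ _ (∷ʳ-⊑ y₁ y′ y⊑)
    y⊑gy : y₁ ⊑[ c′ ] restrict f c′ y₁
    y⊑gy i e = trans (lookup∘tabulate _ i)
      (up y₁ (λ _ → id) (inject₁ i)
        (trans (sym (lookup∘tabulate _ i)) (trans (cong (λ t → lookup t i) y-fixed) e)))
    z-fixed : restrict f c′ z₁ ≡ z₁
    z-fixed = complete-fixes {f = restrict f c′} g-iso complete y⊑gy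
    -- At `y₁ Vec.∷ʳ b` the last component of `f` is `c′` by definition; since `y₁ ⊑[ c′ ] z₁`,
    -- isotony carries this value over to `z₁ Vec.∷ʳ c′`.
    last-fixed : lookup (f (z₁ Vec.∷ʳ c′)) (fromℕ n) ≡ c′
    last-fixed = up z₁ (run-⊆ {f = restrict f c′} {x = y₁} g-iso (minimum v) (λ _ → id) y⊑gy) (fromℕ n) refl

W-fixes : (ω : ∀ k → Word k) → (∀ k → 1 ≤ k → Complete (ω k)) →
          ∀ n → 1 ≤ n → FixesAllMonotone (W ω n)
W-fixes ω complete (suc zero) _ =
  -- The one-letter word is the extension of the empty word, which fixes everything on the single
  -- state of `State 0`.
  fixes-extend [] [] (λ f _ x → unique (f x) x) λ p p↭ →
    subst (_⊆ []) (sym (↭-empty-inv p↭)) []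
  where
  unique : (x y : State 0) → x ≡ y
  unique Vec.[] Vec.[] = refl
W-fixes ω complete (suc n@(suc _)) _ =
  fixes-extend (W ω n) (ω n) (W-fixes ω complete n (s≤s z≤n)) (complete n (s≤s z≤n))

-- Complete words of quadratic length.

-- zero is the letter to be inserted into the cyclic word of the others.

Cyclic : ℕ → (ℕ → Fin (suc n)) → Set
Cyclic q s = ∀ a {x} → zero ≢ x → ∃ λ d → d ≤ q × s (a + d) ≡ x

module _ {q : ℕ} where

  shift-cyclic : (s : ℕ → Fin (suc n)) → Cyclic q s → ∀ b → Cyclic q (s ∘ (_+_ b))
  shift-cyclic s cyc b a x≢0 =
    let d , d≤q , e = cyc (b + a) x≢0 in d , d≤q , trans (cong s (sym (+-assoc b a d))) e

  -- The situation just after `x` has been read: the next letter is not `x`, so `q` positions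
  -- suffice where `Cyclic` needs `q + 1`.
  Follows : Fin (suc n) → (ℕ → Fin (suc n)) → Set
  Follows x s = ∀ {y} → zero ≢ y → x ≢ y → ∃ λ d → d < q × s d ≡ y

  -- Counted from position `d`, offset zero would give `s d` itself; any other letter has offset
  -- `suc k` with `k < q`.
  follows : (s : ℕ → Fin (suc n)) → Cyclic q s → ∀ d → Follows (s d) (s ∘ (_+_ (suc d)))
  follows s cyc d y≢0 sd≢y with cyc d y≢0
  ... | zero  , _   , e = contradiction (trans (cong s (sym (+-identityʳ d))) e) sd≢y
  ... | suc k , k<q , e = k , k<q , trans (cong s (sym (+-suc d k))) e

  ∷-⊆-applyUpTo : ∀ {A : Set} (s : ℕ → A) {u} d {k} → u ⊆ applyUpTo (s ∘ (_+_ (suc d))) k →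
                  s d ∷ u ⊆ applyUpTo s (suc d + k)
  ∷-⊆-applyUpTo s zero    u⊆ = refl ∷ u⊆
  ∷-⊆-applyUpTo s (suc d) u⊆ = s 0 ∷ʳ ∷-⊆-applyUpTo (s ∘ suc) d u⊆

  -- Greedy embedding: each letter differs from its predecessor and hence uses up at most `q`
  -- positions.
  unique-⊆-follows : ∀ (s : ℕ → Fin (suc n)) {x u} → Cyclic q s → Follows x s →
                     Unique (x ∷ u) → All (zero ≢_) u → ∀ k → length u * q ≤ k →
                     u ⊆ applyUpTo s k
  unique-⊆-follows s {u = []} _ _ _ _ k _ = minimum _
  unique-⊆-follows s {u = y ∷ u} cyc fol ((x≢y ∷ _) ∷ uniq) (y≢0 ∷ u≢0) k ≤k
    with fol y≢0 x≢y
  ... | d , d<q , refl = subst (λ k → y ∷ u ⊆ applyUpTo s k) (m+[n∸m]≡n d<k)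
    (∷-⊆-applyUpTo s d (unique-⊆-follows (s ∘ (_+_ (suc d)))
      (shift-cyclic s cyc (suc d)) (follows s cyc d) uniq u≢0 _
      (m+n≤o⇒m≤o∸n (length u * q) (≤-trans (+-monoʳ-≤ (length u * q) d<q)
        (≤-trans (≤-reflexive (+-comm (length u * q) q)) ≤k)))))
    where
    d<k : d < k
    d<k = ≤-trans d<q (≤-trans (m≤m+n q _) ≤k)

  -- The first letter has no predecessor and may cost `q + 1` positions, whence the `suc`.
  unique-⊆ : ∀ (s : ℕ → Fin (suc n)) {u} → Cyclic q s → Unique u → All (zero ≢_) u →
             u ⊆ applyUpTo s (suc (length u * q))
  unique-⊆ s {u = []} _ _ _ = minimum _
  unique-⊆ s {x ∷ u} cyc uniq (x≢0 ∷ u≢0) with cyc 0 x≢0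
  ... | d , d≤q , refl = subst (λ k → x ∷ u ⊆ applyUpTo s (suc k)) eq
    (∷-⊆-applyUpTo s d (unique-⊆-follows (s ∘ (_+_ (suc d)))
      (shift-cyclic s cyc (suc d)) (follows s cyc d) uniq u≢0
      -- The `q ∸ d` positions saved on the first letter are padding that makes the total
      -- independent of `d`.
      (q ∸ d + length u * q) (m≤n+m _ (q ∸ d))))
    where
    eq : d + (q ∸ d + length u * q) ≡ q + length u * q
    eq = trans (sym (+-assoc d _ _)) (cong (_+ length u * q) (m+[n∸m]≡n d≤q))

  applyUpTo-+ : ∀ {A : Set} (s : ℕ → A) k l →
                applyUpTo s (k + l) ≡ applyUpTo s k ++ applyUpTo (s ∘ (_+_ k)) l
  applyUpTo-+ s zero    l = refl
  applyUpTo-+ s (suc k) l = cong (s 0 ∷_) (applyUpTo-+ (s ∘ suc) k l)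

  -- The letter after the last `zero` is the extra position that `unique-⊆` charges for the first
  -- letter behind the chosen `zero`.
  interleave : (ℕ → Fin (suc n)) → ℕ → Word (suc n)
  interleave s zero    = zero ∷ s 0 ∷ []
  interleave s (suc k) = zero ∷ applyUpTo s q ++ interleave (s ∘ (_+_ q)) k

  length-interleave : ∀ (s : ℕ → Fin (suc n)) k → length (interleave s k) ≡ 2 + k * suc q
  length-interleave s zero    = refl
  length-interleave s (suc k) = cong suc (begin
    length (applyUpTo s q ++ interleave (s ∘ (_+_ q)) k)
      ≡⟨ length-++ (applyUpTo s q) ⟩
    length (applyUpTo s q) + length (interleave (s ∘ (_+_ q)) k)
      ≡⟨ cong₂ _+_ (length-applyUpTo s q) (length-interleave (s ∘ (_+_ q)) k) ⟩
    q + (2 + k * suc q)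
      ≡⟨ shuffle q (k * suc q) ⟩
    suc (suc q + k * suc q) ∎)
    where
    open ≡-Reasoning
    shuffle : ∀ a b → a + (2 + b) ≡ suc (suc a + b)
    shuffle = solve-∀

  -- Keep the first `zero` and drop all later ones; `∷ˡ⁻` discards the one opening the next block.
  zero∷-⊆-interleave : ∀ (s : ℕ → Fin (suc n)) l →
                       zero ∷ applyUpTo s (l * q + 1) ⊆ interleave s l
  zero∷-⊆-interleave s zero    = ⊆-refl
  zero∷-⊆-interleave s (suc l) = refl ∷ subst (_⊆ applyUpTo s q ++ interleave (s ∘ (_+_ q)) l) (sym eq)
    (++⁺ (⊆-refl {x = applyUpTo s q}) (∷ˡ⁻ (zero∷-⊆-interleave (s ∘ (_+_ q)) l)))
    where
    eq : applyUpTo s (q + l * q + 1) ≡ applyUpTo s q ++ applyUpTo (s ∘ (_+_ q)) (l * q + 1)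
    eq = trans (cong (applyUpTo s) (+-assoc q (l * q) 1)) (applyUpTo-+ s q _)

  -- Of the `k + l + 1` occurrences of `zero`, keep only the one after `k` blocks. The sequence `t`
  -- is `s` advanced by those `k` blocks.
  split-⊆-interleave : ∀ (s : ℕ → Fin (suc n)) → Cyclic q s → ∀ k l → ∃ λ t → Cyclic q t ×
                       applyUpTo s (k * q) ++ zero ∷ applyUpTo t (l * q + 1) ⊆ interleave s (k + l)
  split-⊆-interleave s cyc zero    l = s , cyc , zero∷-⊆-interleave s l
  split-⊆-interleave s cyc (suc k) l =
    let t , cyc′ , τ = split-⊆-interleave (s ∘ (_+_ q)) (shift-cyclic s cyc q) k l in
    t , cyc′ , zero ∷ʳ subst (_⊆ applyUpTo s q ++ interleave (s ∘ (_+_ q)) (k + l))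
      (sym (trans (cong (_++ zero ∷ applyUpTo t (l * q + 1)) (applyUpTo-+ s q (k * q)))
        (++-assoc (applyUpTo s q) _ _)))
      (++⁺ (⊆-refl {x = applyUpTo s q}) τ)

unique-++⁻ : ∀ {A : Set} (u : List A) {v} → Unique (u ++ v) → Unique u × Unique v
unique-++⁻ []      uniq         = [] , uniq
unique-++⁻ (x ∷ u) (x∉ ∷ uniq) =
  let uniq₁ , uniq₂ = unique-++⁻ u uniq in All.++⁻ˡ u x∉ ∷ uniq₁ , uniq₂

-- A permutation u, zero, v uses the zero placed after the first |u| q + 1
-- cyclic letters: they contain u, and |v| q + 1 cyclic letters remain for v.

interleave-complete : ∀ {m q} (s : ℕ → Fin (suc m)) → Cyclic q s →
                      Complete (s 0 ∷ interleave {q = q} (s ∘ suc) m)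
interleave-complete {m} {q} s cyc p p↭ with ∈-∃++ (∈-resp-↭ (↭-sym p↭) (∈-allFin zero))
... | u , v , refl
  with ↭ₛ.Unique-resp-↭ (setoid _) (↭⇒↭ₛ (↭-trans (↭-sym p↭) (shift zero u v))) (allFin⁺ (suc m))
... | ≢0 ∷ uniq with split-⊆-interleave (s ∘ suc) (shift-cyclic s cyc 1) (length u) (length v)
... | t , cyc′ , τ = subst (λ k → u ++ zero ∷ v ⊆ s 0 ∷ interleave (s ∘ suc) k) len
  (⊆-trans (++⁺ (unique-⊆ s cyc (proj₁ (unique-++⁻ u uniq)) (All.++⁻ˡ u ≢0))
                (refl ∷ subst (λ k → v ⊆ applyUpTo t k) (+-comm 1 _)
                          (unique-⊆ t cyc′ (proj₂ (unique-++⁻ u uniq)) (All.++⁻ʳ u ≢0))))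
           (refl ∷ τ))
  where
  len : length u + length v ≡ m
  len = suc-injective (begin
    suc (length u + length v)    ≡⟨ cong suc (length-++ u) ⟨
    length (zero ∷ u ++ v)       ≡⟨ ↭-length (shift zero u v) ⟨
    length (u ++ zero ∷ v)       ≡⟨ ↭-length p↭ ⟩
    length (allFin (suc m))      ≡⟨ length-tabulate id ⟩
    suc m                        ∎)
    where open ≡-Reasoning

cycle : ∀ q → ℕ → Fin (2 + q)
cycle q i = suc (i mod suc q)

cycle-cyclic : ∀ q → Cyclic q (cycle q)
cycle-cyclic q a {zero}  0≢0 = contradiction refl 0≢0
cycle-cyclic q a {suc x} _   = d , s≤s⁻¹ (m%n<n e (suc q)) , cong suc (toℕ-injective (begin
    toℕ ((a + d) mod m)                   ≡⟨ toℕ-fromℕ< _ ⟩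
    (a + d) % m                           ≡⟨ %-distribˡ-+ a d m ⟩
    (a % m + e % m % m) % m               ≡⟨ cong (λ t → (a % m + t) % m) (m%n%n≡m%n e m) ⟩
    (a % m + e % m) % m                   ≡⟨ %-distribˡ-+ a e m ⟨
    (a + e) % m                           ≡⟨ cong (_% m) a+e ⟩
    (toℕ x + suc (a ℕ./ m) * m) % m         ≡⟨ [m+kn]%n≡m%n (toℕ x) (suc (a ℕ./ m)) m ⟩
    toℕ x % m                             ≡⟨ m<n⇒m%n≡m (toℕ<n x) ⟩
    toℕ x                                 ∎))
  where
  open ≡-Reasoning
  m = suc q
  -- Modulo `m` this is `x - a`, with `m ∸ a % m` standing for `- a` within ℕ.
  e = toℕ x + (m ∸ a % m)
  d = e % m
  shuffle : ∀ r t x c → r + t + (x + c) ≡ x + (r + c + t)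
  shuffle = solve-∀
  a+e : a + e ≡ toℕ x + suc (a ℕ./ m) * m
  a+e = begin
    a + e
      ≡⟨ cong (_+ e) (m≡m%n+[m/n]*n a m) ⟩
    a % m + a ℕ./ m * m + (toℕ x + (m ∸ a % m))
      ≡⟨ shuffle (a % m) (a ℕ./ m * m) (toℕ x) (m ∸ a % m) ⟩
    toℕ x + (a % m + (m ∸ a % m) + a ℕ./ m * m)
      ≡⟨ cong (λ t → toℕ x + (t + a ℕ./ m * m)) (m+[n∸m]≡n (m%n≤n a m)) ⟩
    toℕ x + suc (a ℕ./ m) * m ∎

-- At `n = m + 1` this is the known bound `n² - 2n + 4`; the word has `m` blocks of length `m` and
-- three further letters.
Λ-suc≤ : ∀ m → Λ (suc m) ≤ m * m + 3
-- There are no nonzero letters to cycle through, so a one-letter word is used directly.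
Λ-suc≤ zero    = ≤-trans (proj₂ (Λ-isLeast 1) [ zero ] complete₁) (s≤s z≤n)
  where
  complete₁ : Complete [ zero ]
  complete₁ p p↭ with refl ← ↭-singleton-inv p↭ = ⊆-refl
Λ-suc≤ m@(suc q) = ≤-trans (proj₂ (Λ-isLeast (suc m)) _ (interleave-complete (cycle q) (cycle-cyclic q)))
  (≤-reflexive (trans (cong suc (length-interleave {q = q} _ m)) (+-comm 3 _)))

-- Summation and the cubic bound.

∑Λ-suc : ∀ m → ∑Λ (suc m) ≡ ∑Λ m + Λ (suc m)
∑Λ-suc m = begin
  sum (map Λ⁺ (upTo (suc m)))        ≡⟨ cong (sum ∘ map Λ⁺) (upTo-∷ʳ m) ⟨
  sum (map Λ⁺ (upTo m ++ [ m ]))     ≡⟨ cong sum (map-++ Λ⁺ (upTo m) [ m ]) ⟩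
  sum (map Λ⁺ (upTo m) ++ [ Λ⁺ m ])  ≡⟨ sum-++ (map Λ⁺ (upTo m)) [ Λ⁺ m ] ⟩
  ∑Λ m + (Λ⁺ m + 0)                  ≡⟨ cong (_+_ (∑Λ m)) (+-identityʳ (Λ⁺ m)) ⟩
  ∑Λ m + Λ⁺ m                        ∎
  where
  open ≡-Reasoning
  Λ⁺ : ℕ → ℕ
  Λ⁺ i = Λ (suc i)

-- ∑_{i<m} (i² + 3) = (2m³ − 3m² + 19m) / 6

∑Λ-bound : ∀ m → 6 * ∑Λ m + 3 * (m * m) ≤ 2 * (m * m * m) + 19 * m
∑Λ-bound zero    = z≤n
∑Λ-bound (suc m) = begin
  6 * ∑Λ (suc m) + 3 * (suc m * suc m)
    ≡⟨ cong (λ t → 6 * t + 3 * (suc m * suc m)) (∑Λ-suc m) ⟩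
  6 * (∑Λ m + Λ (suc m)) + 3 * (suc m * suc m)
    ≤⟨ +-monoˡ-≤ _ (*-monoʳ-≤ 6 (+-monoʳ-≤ (∑Λ m) (Λ-suc≤ m))) ⟩
  6 * (∑Λ m + (m * m + 3)) + 3 * (suc m * suc m)
    ≡⟨ regroup (∑Λ m) m ⟩
  (6 * ∑Λ m + 3 * (m * m)) + (6 * (m * m) + 6 * m + 21)
    ≤⟨ +-monoˡ-≤ _ (∑Λ-bound m) ⟩
  (2 * (m * m * m) + 19 * m) + (6 * (m * m) + 6 * m + 21)
    ≡⟨ collect m ⟩
  2 * (suc m * suc m * suc m) + 19 * suc m ∎
  where
  open ≤-Reasoning
  regroup : ∀ S m → 6 * (S + (m * m + 3)) + 3 * ((1 + m) * (1 + m)) ≡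
                    (6 * S + 3 * (m * m)) + (6 * (m * m) + 6 * m + 21)
  regroup = solve-∀
  collect : ∀ m → (2 * (m * m * m) + 19 * m) + (6 * (m * m) + 6 * m + 21) ≡
                  2 * ((1 + m) * (1 + m) * (1 + m)) + 19 * (1 + m)
  collect = solve-∀

length-W : (ω : ∀ k → Word k) → (∀ k → 1 ≤ k → length (ω k) ≡ Λ k) →
           ∀ m → length (W ω (suc m)) ≡ suc m + ∑Λ m
length-W ω len zero    = refl
length-W ω len (suc m) = begin
  length (map inject₁ (W ω (suc m)) ++ fromℕ (suc m) ∷ map inject₁ (ω (suc m)))
    ≡⟨ length-++ (map inject₁ (W ω (suc m))) ⟩
  length (map inject₁ (W ω (suc m))) + suc (length (map inject₁ (ω (suc m))))
    ≡⟨ cong₂ (λ a b → a + suc b) (trans (length-map inject₁ (W ω (suc m))) (length-W ω len m))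
                                 (trans (length-map inject₁ (ω (suc m))) (len (suc m) (s≤s z≤n))) ⟩
  suc m + ∑Λ m + suc (Λ (suc m))
    ≡⟨ shuffle m (∑Λ m) (Λ (suc m)) ⟩
  suc (suc m) + (∑Λ m + Λ (suc m))
    ≡⟨ cong (_+_ (suc (suc m))) (∑Λ-suc m) ⟨
  suc (suc m) + ∑Λ (suc m) ∎
  where
  open ≡-Reasoning
  shuffle : ∀ m S t → suc m + S + suc t ≡ suc (suc m) + (S + t)
  shuffle = solve-∀

cubic-bound : ∀ m → 6 * (suc m + ∑Λ m) + 3 * (3 * suc m ^ 2) ≤ 2 * suc m ^ 3 + 37 * suc m
cubic-bound m = begin
  6 * (suc m + ∑Λ m) + 3 * (3 * suc m ^ 2)
    ≡⟨ regroup (∑Λ m) m ⟩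
  (6 * ∑Λ m + 3 * (m * m)) + (6 * (m * m) + 24 * m + 15)
    -- The cubic equals `n` plus the sum of `i² - 2i + 4` over `0 ≤ i < n`. Its term 4 at `i = 0` is
    -- absent from `∑Λ m`; multiplied by 6 it is the slack 24.
    ≤⟨ +-mono-≤ (∑Λ-bound m) (+-monoʳ-≤ (6 * (m * m) + 24 * m) (m≤m+n 15 24)) ⟩
  (2 * (m * m * m) + 19 * m) + (6 * (m * m) + 24 * m + 39)
    ≡⟨ collect m ⟩
  2 * suc m ^ 3 + 37 * suc m ∎
  where
  open ≤-Reasoning
  regroup : ∀ S m → 6 * ((1 + m) + S) + 3 * (3 * ((1 + m) * ((1 + m) * 1))) ≡
                    (6 * S + 3 * (m * m)) + (6 * (m * m) + 24 * m + 15)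
  regroup = solve-∀
  collect : ∀ m → (2 * (m * m * m) + 19 * m) + (6 * (m * m) + 24 * m + 39) ≡
                  2 * ((1 + m) * ((1 + m) * ((1 + m) * 1))) + 37 * (1 + m)
  collect = solve-∀

-- The hypothesis is the conclusion times 6, with the negative term moved across to stay in ℕ.
-- Unnormalised rationals keep the denominators literal, so the comparison becomes one of integers.
over-common-denominator : ∀ N a b c → 6 * N + 3 * b ≤ 2 * a + c →
  + N / 1 ℚ.≤ (+ a / 3) ℚ.- (+ b / 2) ℚ.+ (+ c / 6)
over-common-denominator N a b c h = ℚ.toℚᵘ-cancel-≤ (begin
  ℚ.toℚᵘ (+ N / 1)                                         ≃⟨ ℚ.toℚᵘ-fromℚᵘ (+ N ℚᵘ./ 1) ⟩
  + N ℚᵘ./ 1                                               ≤⟨ ℚᵘ.*≤* ineq ⟩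
  (+ a ℚᵘ./ 3) ℚᵘ.- (+ b ℚᵘ./ 2) ℚᵘ.+ (+ c ℚᵘ./ 6)         ≃⟨ homo ⟨
  ℚ.toℚᵘ ((+ a / 3) ℚ.- (+ b / 2) ℚ.+ (+ c / 6))           ∎)
  where
  open ℚᵘ.≤-Reasoning
  homo : ℚ.toℚᵘ ((+ a / 3) ℚ.- (+ b / 2) ℚ.+ (+ c / 6)) ℚᵘ.≃
         (+ a ℚᵘ./ 3) ℚᵘ.- (+ b ℚᵘ./ 2) ℚᵘ.+ (+ c ℚᵘ./ 6)
  homo = ℚᵘ.≃-trans (ℚ.toℚᵘ-homo-+ ((+ a / 3) ℚ.- (+ b / 2)) (+ c / 6))
    (ℚᵘ.+-cong
      (ℚᵘ.≃-trans (ℚ.toℚᵘ-homo-+ (+ a / 3) (ℚ.- (+ b / 2)))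
        (ℚᵘ.+-cong (ℚ.toℚᵘ-fromℚᵘ (+ a ℚᵘ./ 3))
          (ℚᵘ.≃-trans (ℚ.toℚᵘ-homo‿- (+ b / 2)) (ℚᵘ.-‿cong (ℚ.toℚᵘ-fromℚᵘ (+ b ℚᵘ./ 2))))))
      (ℚ.toℚᵘ-fromℚᵘ (+ c ℚᵘ./ 6)))
  lhs : ∀ N b → N ℤ.* + 36 ≡ + 6 ℤ.* (+ 6 ℤ.* N ℤ.+ + 3 ℤ.* b) ℤ.+ ℤ.- (+ 18 ℤ.* b)
  lhs = ℤSolver.solve-∀
  rhs : ∀ a b c → + 6 ℤ.* (+ 2 ℤ.* a ℤ.+ c) ℤ.+ ℤ.- (+ 18 ℤ.* b) ≡
                  ((a ℤ.* + 2 ℤ.+ ℤ.- b ℤ.* + 3) ℤ.* + 6 ℤ.+ c ℤ.* + 6) ℤ.* + 1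
  rhs = ℤSolver.solve-∀
  hℤ : + 6 ℤ.* + N ℤ.+ + 3 ℤ.* + b ℤ.≤ + 2 ℤ.* + a ℤ.+ + c
  hℤ = subst₂ ℤ._≤_ (cong₂ ℤ._+_ (ℤ.pos-* 6 N) (ℤ.pos-* 3 b)) (cong (ℤ._+ + c) (ℤ.pos-* 2 a)) (ℤ.+≤+ h)
  -- The factor 36 is the unreduced denominator `3 * 2 * 6`; hence `hℤ` is multiplied by 6 and
  -- `18 * b` subtracted.
  ineq : + N ℤ.* + 36 ℤ.≤ ((+ a ℤ.* + 2 ℤ.+ ℤ.- (+ b) ℤ.* + 3) ℤ.* + 6 ℤ.+ + c ℤ.* + 6) ℤ.* + 1
  ineq = subst₂ ℤ._≤_ (sym (lhs (+ N) (+ b))) (rhs (+ a) (+ b) (+ c))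
    (ℤ.+-monoˡ-≤ (ℤ.- (+ 18 ℤ.* + b)) (ℤ.*-monoˡ-≤-nonNeg (+ 6) hℤ))

theorem11 : (∀ (ω : ∀ k → Word k) → (∀ k → 1 ≤ k → ShortestComplete (ω k)) →
    ∀ n → 1 ≤ n → FixesAllMonotone (W ω n))
    × (∀ n → 1 ≤ n →
    Λᴹ n ≤ n + ∑Λ (n ∸ 1)
    × (+ (n + ∑Λ (n ∸ 1)) / 1) ℚ.≤
    ((+ (n ^ 3) / 3) ℚ.- (+ (3 * n ^ 2) / 2) ℚ.+ (+ (37 * n) / 6)))
theorem11 =
  (λ ω shortest → W-fixes ω λ k 1≤k → proj₁ (shortest k 1≤k)) ,
  λ { n@(suc m) 1≤n →
      ≤-trans (proj₂ (Λᴹ-isLeast n) (W ω n) (W-fixes ω (λ k _ → proj₁ (proj₂ (ω∃ k))) n 1≤n))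
              (≤-reflexive (length-W ω (λ k _ → proj₂ (proj₂ (ω∃ k))) m))
    , over-common-denominator (n + ∑Λ m) (n ^ 3) (3 * n ^ 2) (37 * n) (cubic-bound m) }
  where
  -- The minimum `Λ k` is attained, so an actual family `ω` exists and `W ω n` witnesses the bound
  -- on `Λᴹ n`.
  ω∃ : ∀ k → ∃ (ShortestComplete {k})
  ω∃ k = proj₁ (Λ-isLeast k)
  ω : ∀ k → Word k
  ω k = proj₁ (ω∃ k)
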